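{- Let $m\ge 0$ be an integer and $a=2^m$. Let $d_0,\dots,d_{a^2-1}$ be the difference sequence of the $(a,a)$ game, and let $(p_n,q_n)_{n\ge 0}$ be the sequence of pairs constructed from it as in the context. Then the sequence $(p_n,q_n)$ describes all P-positions of the $(a,a)$ game; that is, up to exchanging the two piles, the P-positions are exactly the pairs $(p_n,q_n)$: $$\{\text{P-positions of the }(a,a)\text{ game}\}=\{(p_n,q_n),(q_n,p_n): n\in\mathbb{Z}_{\ge 0}\}.$$
   Context: The $(a,a)$ game ($a$ a positive integer): positions are pairs $(x,y)\in\mathbb{Z}_{\ge 0}^2$ (sizes of two piles of stones). Two players alternate; a move removes any positive number of stones from one of the piles, or removes the same number $ka$ of stones from both piles, for some integer $k\ge 1$ (pile sizes must stay nonnegative). The player who removes the last stone wins. A P-position (cold position) is a position from which the player about to move cannot win under optimal play; equivalently, every move from it leads to a non-P-position (so $(0,0)$ is a P-position). Positions $(x,y)$ and $(y,x)$ are regarded as the same up to switching piles. Difference sequence of the $(a,a)$ game: each column $\{(i,y): y\ge 0\}$ contains exactly one P-position $(i,y_i)$; for $0\le i\le a^2-1$ put $d_i=y_i-i$. For a set $S$ of nonnegative integers, $\operatorname{mex} S$ is the least nonnegative integer not in $S$ (so $\operatorname{mex}\emptyset=0$). Define recursively for $n\ge 0$ $$P_n=\operatorname{mex}\{P_i,Q_i: 0\le i<n\},\qquad Q_n=P_n+a\left\lfloor \frac{n}{a^2}\right\rfloor .$$ Then define $p_n=P_n$ and $q_n=Q_{n+d_j}$, where $j\in\{0,\dots,a^2-1\}$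 is determined by $n\equiv j \pmod{a^2}$. -}

module Defs where

open import Data.Nat
open import Data.Nat.Properties
open import Data.Nat.Divisibility using (_∣_; _∣?_; divides)
open import Data.Nat.DivMod using (_/_; _%_; _mod_; m≡m%n+[m/n]*n; m%n<n)
open import Data.Nat.Induction using (<-rec)
open import Data.Integer as ℤ using (ℤ; +_; ∣_∣)
import Data.Integer.Properties as ℤ
open import Data.Fin as Fin using (Fin; toℕ; fromℕ<)
import Data.Fin.Properties as Fin
open import Data.List using (List; []; _∷_; _++_; length; tabulate)
open import Data.List.Relation.Unary.Any using (index)
import Data.List.Membership.Setoid.Properties as Membership
open import Data.List.Membership.Propositional using (_∈_; _∉_)
open import Data.List.Membership.Propositional.Properties
  using (∈-tabulate⁺; ∈-tabulate⁻; ∈-++⁺ˡ; ∈-++⁺ʳ; ∈-++⁻)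
open import Data.List.Membership.DecPropositional Data.Nat._≟_ using (_∈?_)
open import Data.Product using (∃; ∃!; _×_; _,_; proj₁; proj₂)
open import Data.Sum using (inj₁; inj₂)
open import Relation.Nullary using (¬_; yes; no; contradiction)
open import Relation.Binary.PropositionalEquality

------------------------------------------------------------------------
-- mex

IsMex : (ℕ → Set) → ℕ → Set
IsMex S n = ¬ S n × (∀ {k} → k < n → S k)

not-all-∈ : (xs : List ℕ) → ¬ (∀ (i : Fin (suc (length xs))) → toℕ i ∈ xs)
not-all-∈ xs all
  with i , j , i<j , eq ← Fin.pigeonhole (n<1+n (length xs)) (λ i → index (all i))
  = <⇒≢ i<j (Membership.index-injective (setoid ℕ) (all i) (all j) eq)

-- A finite set of naturals is given by the list of its elements.
opaque
  mex-exists : (xs : List ℕ) → ∃ (IsMex (_∈ xs))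
  mex-exists xs
    with i , i∉xs , below ← Fin.¬∀⟶∃¬-smallest (suc (length xs))
           (λ i → toℕ i ∈ xs) (λ i → toℕ i ∈? xs) (not-all-∈ xs)
    = toℕ i , i∉xs , λ {k} k<i →
        subst (_∈ xs) (trans (Fin.toℕ-inject (fromℕ< k<i)) (Fin.toℕ-fromℕ< k<i))
          (below (fromℕ< k<i))

mex : List ℕ → ℕ
mex xs = proj₁ (mex-exists xs)

mex-isMex : ∀ xs → IsMex (_∈ xs) (mex xs)
mex-isMex xs = proj₂ (mex-exists xs)

------------------------------------------------------------------------
-- The (a,a) game

Position : Set
Position = ℕ × ℕ

data Move (a : ℕ) : Position → Position → Set where
  fromFirst  : ∀ {x y} s → 1 ≤ s → s ≤ x → Move a (x , y) (x ∸ s , y)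
  fromSecond : ∀ {x y} s → 1 ≤ s → s ≤ y → Move a (x , y) (x , y ∸ s)
  fromBoth   : ∀ {x y} k → 1 ≤ k → k * a ≤ x → k * a ≤ y →
               Move a (x , y) (x ∸ k * a , y ∸ k * a)

-- Since the player who takes the last stone wins, a player without a move
-- has lost: (0 , 0) is vacuously a P-position.
mutual
  data PPosition (a : ℕ) (p : Position) : Set where
    allMoves : (∀ {r} → Move a p r → NPosition a r) → PPosition a p

  data NPosition (a : ℕ) (p : Position) : Set where
    someMove : ∀ {r} → Move a p r → PPosition a r → NPosition a p

N⇒¬P : ∀ {a p} → NPosition a p → ¬ PPosition a p
N⇒¬P (someMove m (allMoves g)) (allMoves f) = N⇒¬P (f m) (allMoves g)

------------------------------------------------------------------------
-- Every column contains exactly one P-position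

module _ (a : ℕ) .{{_ : NonZero a}} where

  Column : ℕ → Set
  Column i = ∃ λ y → PPosition a (i , y) × (∀ z → z ≢ y → NPosition a (i , z))

  private
    1≤k*a : ∀ {k} → 1 ≤ k → 1 ≤ k * a
    1≤k*a {k} 1≤k = *-mono-≤ 1≤k (>-nonZero⁻¹ a)

    column-step : ∀ i → (∀ {x} → x < i → Column x) → Column i
    column-step i ih = v , isP , isN
      where
      col : (j : Fin i) → Column (toℕ j)
      col j = ih (Fin.toℕ<n j)

      y : Fin i → ℕ
      y j = proj₁ (col j)

      diag : Fin i → ℕ
      diag j with a ∣? (i ∸ toℕ j)
      ... | yes _ = y j + (i ∸ toℕ j)
      ... | no  _ = y j

      blocked : List ℕ
      blocked = tabulate y ++ tabulate diag

      v : ℕ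
      v = mex blocked

      v∉ : v ∉ blocked
      v∉ = proj₁ (mex-isMex blocked)

      back : ∀ (j : Fin i) → i ∸ (i ∸ toℕ j) ≡ toℕ j
      back j = m∸[m∸n]≡n (<⇒≤ (Fin.toℕ<n j))

      row-N : ∀ j → NPosition a (i , y j)
      row-N j = someMove
        (fromFirst (i ∸ toℕ j) (m<n⇒0<n∸m (Fin.toℕ<n j)) (m∸n≤m i (toℕ j)))
        (subst (λ x → PPosition a (x , y j)) (sym (back j)) (proj₁ (proj₂ (col j))))

      diag-N : ∀ j → NPosition a (i , diag j)
      diag-N j with a ∣? (i ∸ toℕ j)
      ... | no  _ = row-N j
      ... | yes (divides k eq) = someMove
        (fromBoth k (k≥1 k eq) (subst (_≤ i) eq (m∸n≤m i (toℕ j)))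
          (subst (_≤ y j + (i ∸ toℕ j)) eq (m≤n+m (i ∸ toℕ j) (y j))))
        (subst₂ (λ s t → PPosition a (s , t))
          (trans (sym (back j)) (cong (i ∸_) eq))
          (trans (sym (m+n∸n≡m (y j) (i ∸ toℕ j))) (cong (y j + (i ∸ toℕ j) ∸_) eq))
          (proj₁ (proj₂ (col j))))
        where
        k≥1 : ∀ k → i ∸ toℕ j ≡ k * a → 1 ≤ k
        k≥1 zero    eq = contradiction (sym eq) (<⇒≢ (m<n⇒0<n∸m (Fin.toℕ<n j)))
        k≥1 (suc _) _  = s≤s z≤n

      blocked-N : ∀ {z} → z ∈ blocked → NPosition a (i , z)
      blocked-N z∈ with ∈-++⁻ (tabulate y) z∈
      ... | inj₁ z∈y with j , refl ← ∈-tabulate⁻ {f = y} z∈y = row-N j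
      ... | inj₂ z∈d with j , refl ← ∈-tabulate⁻ {f = diag} z∈d = diag-N j

      below-N : ∀ {z} → z < v → NPosition a (i , z)
      below-N z<v = blocked-N (proj₂ (mex-isMex blocked) z<v)

      diag-eq : ∀ j k → i ∸ toℕ j ≡ k * a → diag j ≡ y j + k * a
      diag-eq j k eq with a ∣? (i ∸ toℕ j)
      ... | yes _  = cong (_+_ (y j)) eq
      ... | no a∤ = contradiction (divides k eq) a∤

      earlier-N : ∀ s z → 1 ≤ s → s ≤ i →
                  (∀ j → toℕ j ≡ i ∸ s → z ≢ y j) → NPosition a (i ∸ s , z)
      earlier-N s z 1≤s s≤i z≢ =
        subst (λ x → NPosition a (x , z)) eq (proj₂ (proj₂ (col j)) z (z≢ j eq))
        where
        lt : i ∸ s < i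
        lt = ∸-monoʳ-< 1≤s s≤i
        j : Fin i
        j = fromℕ< lt
        eq : toℕ j ≡ i ∸ s
        eq = Fin.toℕ-fromℕ< lt

      isP : PPosition a (i , v)
      isP = allMoves λ where
        (fromFirst s 1≤s s≤i) → earlier-N s v 1≤s s≤i λ j _ v≡y →
          v∉ (subst (_∈ blocked) (sym v≡y) (∈-++⁺ˡ (∈-tabulate⁺ {f = y} j)))
        (fromSecond s 1≤s s≤v) → below-N (∸-monoʳ-< 1≤s s≤v)
        (fromBoth k 1≤k ka≤i ka≤v) →
          earlier-N (k * a) (v ∸ k * a) (1≤k*a 1≤k) ka≤i λ j j≡ v∸≡y →
          v∉ (subst (_∈ blocked)
            (trans (diag-eq j k (trans (cong (i ∸_) j≡) (m∸[m∸n]≡n ka≤i)))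
              (trans (cong (_+ k * a) (sym v∸≡y)) (m∸n+n≡m ka≤v)))
            (∈-++⁺ʳ (tabulate y) (∈-tabulate⁺ {f = diag} j)))

      isN : ∀ z → z ≢ v → NPosition a (i , z)
      isN z z≢v with z <? v
      ... | yes z<v = below-N z<v
      ... | no  z≮v = someMove
        (fromSecond (z ∸ v) (m<n⇒0<n∸m v<z) (m∸n≤m z v))
        (subst (λ t → PPosition a (i , t)) (sym (m∸[m∸n]≡n (<⇒≤ v<z))) isP)
        where
        v<z : v < z
        v<z = ≤∧≢⇒< (≮⇒≥ z≮v) (λ v≡z → z≢v (sym v≡z))

  opaque
    column : ∀ i → Column i
    column = <-rec Column column-step

  column-unique : ∀ i → ∃! _≡_ (λ y → PPosition a (i , y))
  column-unique i = y , proj₁ (proj₂ (column i)) , unique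
    where
    y : ℕ
    y = proj₁ (column i)

    unique : ∀ {z} → PPosition a (i , z) → y ≡ z
    unique {z} Pz with z ≟ y
    ... | yes z≡y = sym z≡y
    ... | no  z≢y = contradiction Pz (N⇒¬P (proj₂ (proj₂ (column i)) z z≢y))

  columnHeight : ℕ → ℕ
  columnHeight i = proj₁ (column-unique i)

------------------------------------------------------------------------
-- The difference sequence and the sequences built from it

private
  cancel-middle : ∀ r j h → + (r + j) ℤ.+ (+ h ℤ.- + j) ≡ + (r + h)
  cancel-middle r j h = begin
    + r ℤ.+ + j ℤ.+ (+ h ℤ.- + j)          ≡⟨ ℤ.+-assoc (+ r) (+ j) (+ h ℤ.- + j) ⟩
    + r ℤ.+ (+ j ℤ.+ (+ h ℤ.- + j))        ≡⟨ cong (ℤ._+_ (+ r)) (ℤ.+-comm (+ j) (+ h ℤ.- + j)) ⟩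
    + r ℤ.+ (+ h ℤ.- + j ℤ.+ + j)          ≡⟨ cong (ℤ._+_ (+ r)) (ℤ.+-assoc (+ h) (ℤ.- (+ j)) (+ j)) ⟩
    + r ℤ.+ (+ h ℤ.+ (ℤ.- (+ j) ℤ.+ + j))  ≡⟨ cong (λ t → + r ℤ.+ (+ h ℤ.+ t)) (ℤ.+-inverseˡ (+ j)) ⟩
    + r ℤ.+ (+ h ℤ.+ + 0)                  ≡⟨ cong (ℤ._+_ (+ r)) (ℤ.+-identityʳ (+ h)) ⟩
    + (r + h)                              ∎
    where open ≡-Reasoning

module _ (a : ℕ) .{{_ : NonZero a}} where

  private instance
    a²≢0 : NonZero (a ^ 2)
    a²≢0 = m^n≢0 a 2

  d : Fin (a ^ 2) → ℤ
  d j = + columnHeight a (toℕ j) ℤ.- + toℕ j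

  mutual
    -- the elements of {P i , Q i : 0 ≤ i < n}
    previous : ℕ → List ℕ
    previous zero    = []
    previous (suc n) = P n ∷ Q n ∷ previous n

    P : ℕ → ℕ
    P n = mex (previous n)

    Q : ℕ → ℕ
    Q n = P n + a * (n / a ^ 2)

  -- n + d_j for n ≡ j (mod a²).  It is nonnegative (shifted-nonneg), so the
  -- absolute value taken below is only the passage from ℤ to ℕ.
  shifted : ℕ → ℤ
  shifted n = + n ℤ.+ d (n mod (a ^ 2))

  shifted-nonneg : ∀ n → + ∣ shifted n ∣ ≡ shifted n
  shifted-nonneg n = ℤ.0≤i⇒+∣i∣≡i (subst (+ 0 ℤ.≤_) (sym eq) (ℤ.+≤+ z≤n))
    where
    j h r : ℕ
    j = toℕ (n mod (a ^ 2))
    h = columnHeight a j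
    r = n / a ^ 2 * a ^ 2
    n≡ : n ≡ r + j
    n≡ = trans (m≡m%n+[m/n]*n n (a ^ 2)) (trans (+-comm (n % a ^ 2) r)
           (cong (_+_ r) (sym (Fin.toℕ-fromℕ< (m%n<n n (a ^ 2))))))
    eq : shifted n ≡ + (r + h)
    eq = trans (cong (λ t → + t ℤ.+ (+ h ℤ.- + j)) n≡) (cancel-middle r j h)

  p : ℕ → ℕ
  p n = P n

  q : ℕ → ℕ
  q n = Q ∣ shifted n ∣

-- Write x = u a + r with r < a, and call u the block and r the offset of x.  A
-- diagonal move keeps both offsets and the difference of the two blocks, so
-- every pair of offsets carries its own Wythoff-like game on blocks.  With the
-- greedy sequences L_b = mex {L_i , M_i : i < b} and M_b = L_b + ⌊b/a⌋, the
-- P-positions are, up to exchange, the pairs with blocks (L_b , M_b) and offsets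
-- (r , s) whose nim-sum is b mod a.  Since a is a power of two, nim addition is
-- a group operation on the offsets, so that the offsets and the difference of
-- the blocks determine b; its mex property supplies the winning move when the
-- blocks already fit and only the offsets do not.  Finally P_n = L_{⌊n/a⌋} a + n mod a,
-- and j ↦ j + d_j permutes the offsets in block b < a by r ↦ r ⊕ b.
module Submission where

open import Defs
open import Data.Nat
open import Data.Nat.Properties
open import Data.Nat.DivMod
open import Data.Nat.Divisibility using (n∣m*n; m∣m*n)
open import Data.Nat.Induction using (<-rec)
open import Data.Fin using (toℕ)
import Data.Fin.Properties as Fin
open import Data.Integer as ℤ using (∣_∣)
import Data.Integer.Properties as ℤ
open import Data.List using (List; []; _∷_)
open import Data.List.Membership.Propositional using (_∈_)
open import Data.List.Relation.Unary.Any using (here; there)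
open import Data.Product using (∃; _×_; _,_; proj₁; proj₂; swap)
open import Data.Sum as Sum using (_⊎_; inj₁; inj₂)
open import Function.Base using (_∘_)
open import Function.Bundles using (_⇔_; mk⇔)
open import Relation.Binary using (tri<; tri≈; tri>)
open import Relation.Binary.PropositionalEquality
open import Relation.Nullary using (¬_; contradiction)

-- Division with remainder

module _ (n : ℕ) .{{_ : NonZero n}} where

  [r+kn]%n≡r : ∀ {r} k → r < n → (r + k * n) % n ≡ r
  [r+kn]%n≡r {r} k r<n = trans ([m+kn]%n≡m%n r k n) (m<n⇒m%n≡m r<n)

  [r+kn]/n≡k : ∀ {r} k → r < n → (r + k * n) / n ≡ k
  [r+kn]/n≡k {r} k r<n = begin
    (r + k * n) / n    ≡⟨ +-distrib-/-∣ʳ r (n∣m*n k) ⟩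
    r / n + k * n / n  ≡⟨ cong₂ _+_ (m<n⇒m/n≡0 r<n) (m*n/n≡m k n) ⟩
    k                  ∎
    where open ≡-Reasoning

  %-/-injective : ∀ {x y} → x % n ≡ y % n → x / n ≡ y / n → x ≡ y
  %-/-injective {x} {y} r≡ k≡ = begin
    x                  ≡⟨ m≡m%n+[m/n]*n x n ⟩
    x % n + x / n * n  ≡⟨ cong₂ (λ r k → r + k * n) r≡ k≡ ⟩
    y % n + y / n * n  ≡⟨ m≡m%n+[m/n]*n y n ⟨
    y                  ∎
    where open ≡-Reasoning

  /-cancel-< : ∀ {x y} → x / n < y / n → x < y
  /-cancel-< k< = ≰⇒> λ y≤x → <⇒≱ k< (/-monoˡ-≤ n y≤x)

  %-<⇒< : ∀ {x y} → x / n ≡ y / n → x % n < y % n → x < y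
  %-<⇒< {x} {y} k≡ r< = begin-strict
    x                  ≡⟨ m≡m%n+[m/n]*n x n ⟩
    x % n + x / n * n  <⟨ +-monoˡ-< (x / n * n) r< ⟩
    y % n + x / n * n  ≡⟨ cong (λ k → y % n + k * n) k≡ ⟩
    y % n + y / n * n  ≡⟨ m≡m%n+[m/n]*n y n ⟨
    y                  ∎
    where open ≤-Reasoning

  <⇒/<⊎%< : ∀ {x y} → x < y → x / n < y / n ⊎ (x / n ≡ y / n × x % n < y % n)
  <⇒/<⊎%< {x} {y} x<y with m≤n⇒m<n∨m≡n (/-monoˡ-≤ n (<⇒≤ x<y))
  ... | inj₁ k< = inj₁ k<
  ... | inj₂ k≡ = inj₂ (k≡ , ≰⇒> λ r≥ → <⇒≱ x<y (y≤x r≥))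
    where
    y≤x : y % n ≤ x % n → y ≤ x
    y≤x r≥ with m≤n⇒m<n∨m≡n r≥
    ... | inj₁ r< = <⇒≤ (%-<⇒< (sym k≡) r<)
    ... | inj₂ r≡ = ≤-reflexive (%-/-injective r≡ (sym k≡))

-- Nim addition of m-bit numbers

-- Bitwise exclusive or. Recursion on the number of bits rather than on the arguments discards all
-- higher bits, so the result needs no hypothesis to stay below `2 ^ m`.
nimSum : ℕ → ℕ → ℕ → ℕ
nimSum zero    x y = 0
nimSum (suc m) x y = (x + y) % 2 + nimSum m (x / 2) (y / 2) * 2

nimSum-% : ∀ m x y → nimSum (suc m) x y % 2 ≡ (x + y) % 2
nimSum-% m x y = [r+kn]%n≡r 2 (nimSum m (x / 2) (y / 2)) (m%n<n (x + y) 2)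

nimSum-/ : ∀ m x y → nimSum (suc m) x y / 2 ≡ nimSum m (x / 2) (y / 2)
nimSum-/ m x y = [r+kn]/n≡k 2 (nimSum m (x / 2) (y / 2)) (m%n<n (x + y) 2)

nimSum<2^m : ∀ m x y → nimSum m x y < 2 ^ m
nimSum<2^m zero    x y = z<s
nimSum<2^m (suc m) x y = begin-strict
  (x + y) % 2 + z * 2  <⟨ +-monoˡ-< (z * 2) (m%n<n (x + y) 2) ⟩
  suc z * 2            ≤⟨ *-monoˡ-≤ 2 (nimSum<2^m m (x / 2) (y / 2)) ⟩
  2 ^ m * 2            ≡⟨ *-comm (2 ^ m) 2 ⟩
  2 ^ suc m            ∎
  where
  open ≤-Reasoning
  z : ℕ
  z = nimSum m (x / 2) (y / 2)

nimSum-comm : ∀ m x y → nimSum m x y ≡ nimSum m y x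
nimSum-comm zero    x y = refl
nimSum-comm (suc m) x y =
  cong₂ (λ r k → r % 2 + k * 2) (+-comm x y) (nimSum-comm m (x / 2) (y / 2))

half< : ∀ m {x} → x < 2 ^ suc m → x / 2 < 2 ^ m
half< m {x} x< = m<n*o⇒m/o<n (subst (x <_) (*-comm 2 (2 ^ m)) x<)

[x+y+y]%2≡x%2 : ∀ x y → ((x + y) % 2 + y) % 2 ≡ x % 2
[x+y+y]%2≡x%2 x y = begin
  ((x + y) % 2 + y) % 2              ≡⟨ %-distribˡ-+ ((x + y) % 2) y 2 ⟩
  ((x + y) % 2 % 2 + y % 2) % 2      ≡⟨ cong (λ r → (r + y % 2) % 2) (m%n%n≡m%n (x + y) 2) ⟩
  ((x + y) % 2 + y % 2) % 2          ≡⟨ %-distribˡ-+ (x + y) y 2 ⟨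
  (x + y + y) % 2                    ≡⟨ cong (_% 2) (+-assoc x y y) ⟩
  (x + (y + y)) % 2                  ≡⟨ cong (λ z → (x + (y + z)) % 2) (+-identityʳ y) ⟨
  (x + 2 * y) % 2                    ≡⟨ %-remove-+ʳ x (m∣m*n y) ⟩
  x % 2                              ∎
  where open ≡-Reasoning

-- Adding the same bit twice changes nothing modulo 2. The bound is on `x` alone, whose higher bits
-- would be lost.
nimSum-cancelʳ : ∀ m {x} y → x < 2 ^ m → nimSum m (nimSum m x y) y ≡ x
nimSum-cancelʳ zero    {zero} y _  = refl
nimSum-cancelʳ zero    {suc _} y (s≤s ())
nimSum-cancelʳ (suc m) {x} y x< = %-/-injective 2 rem quot
  where
  open ≡-Reasoning
  z : ℕ
  z = nimSum (suc m) x y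
  rem : nimSum (suc m) z y % 2 ≡ x % 2
  rem = begin
    nimSum (suc m) z y % 2         ≡⟨ nimSum-% m z y ⟩
    (z + y) % 2                    ≡⟨ %-distribˡ-+ z y 2 ⟩
    (z % 2 + y % 2) % 2            ≡⟨ cong (λ r → (r + y % 2) % 2) (nimSum-% m x y) ⟩
    ((x + y) % 2 + y % 2) % 2      ≡⟨ cong (λ r → (r + y % 2) % 2) (m%n%n≡m%n (x + y) 2) ⟨
    ((x + y) % 2 % 2 + y % 2) % 2  ≡⟨ %-distribˡ-+ ((x + y) % 2) y 2 ⟨
    ((x + y) % 2 + y) % 2          ≡⟨ [x+y+y]%2≡x%2 x y ⟩
    x % 2                          ∎
  quot : nimSum (suc m) z y / 2 ≡ x / 2
  quot = begin
    nimSum (suc m) z y / 2                      ≡⟨ nimSum-/ m z y ⟩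
    nimSum m (z / 2) (y / 2)                    ≡⟨ cong (λ k → nimSum m k (y / 2)) (nimSum-/ m x y) ⟩
    nimSum m (nimSum m (x / 2) (y / 2)) (y / 2) ≡⟨ nimSum-cancelʳ m (y / 2) (half< m x<) ⟩
    x / 2                                       ∎

-- The one-bit case of `nimSum-mex`: `c` must be 0 and exactly one of `r` and `s` is 1, and that one
-- drops to 0.
bit-mex : ∀ {r s c} → r < 2 → s < 2 → c < (r + s) % 2 →
          (c + s) % 2 < r ⊎ (r + c) % 2 < s
bit-mex {0} {0}           _ _ ()
bit-mex {0} {1} {zero}    _ _ _ = inj₂ z<s
bit-mex {0} {1} {suc _}   _ _ (s≤s ())
bit-mex {1} {0} {zero}    _ _ _ = inj₁ z<s
bit-mex {1} {0} {suc _}   _ _ (s≤s ())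
bit-mex {1} {1}           _ _ ()
bit-mex {suc (suc _)}     (s≤s (s≤s ()))
bit-mex {_} {suc (suc _)} _ (s≤s (s≤s ()))

-- The mex rule of two-heap nim: a value below the nim-sum is reached by lowering one summand. If
-- `c` and the nim-sum differ above the last bit, induction decides; otherwise the replaced summand
-- keeps its higher bits, and the last bit decides.
nimSum-mex : ∀ m {r s c} → r < 2 ^ m → s < 2 ^ m → c < nimSum m r s →
             nimSum m c s < r ⊎ nimSum m r c < s
nimSum-mex zero    _ _ ()
nimSum-mex (suc m) {r} {s} {c} r< s< c<r⊕s with <⇒/<⊎%< 2 c<r⊕s
... | inj₁ k< = Sum.map
  (λ lt → /-cancel-< 2 (subst (_< r / 2) (sym (nimSum-/ m c s)) lt))
  (λ lt → /-cancel-< 2 (subst (_< s / 2) (sym (nimSum-/ m r c)) lt))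
  (nimSum-mex m (half< m r<) (half< m s<) (subst (c / 2 <_) (nimSum-/ m r s) k<))
... | inj₂ (k≡ , r⊕s>) = Sum.map
  (λ lt → %-<⇒< 2 c⊕s/2 (subst (_< r % 2) (sym (bits c s)) lt))
  (λ lt → %-<⇒< 2 r⊕c/2 (subst (_< s % 2) (sym (bits r c)) lt))
  (bit-mex (m%n<n r 2) (m%n<n s 2) (subst (c % 2 <_) (bits r s) r⊕s>))
  where
  open ≡-Reasoning
  bits : ∀ x y → nimSum (suc m) x y % 2 ≡ (x % 2 + y % 2) % 2
  bits x y = trans (nimSum-% m x y) (%-distribˡ-+ x y 2)
  c/2≡ : c / 2 ≡ nimSum m (r / 2) (s / 2)
  c/2≡ = trans k≡ (nimSum-/ m r s)
  c⊕s/2 : nimSum (suc m) c s / 2 ≡ r / 2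
  c⊕s/2 = begin
    nimSum (suc m) c s / 2                      ≡⟨ nimSum-/ m c s ⟩
    nimSum m (c / 2) (s / 2)                    ≡⟨ cong (λ k → nimSum m k (s / 2)) c/2≡ ⟩
    nimSum m (nimSum m (r / 2) (s / 2)) (s / 2) ≡⟨ nimSum-cancelʳ m (s / 2) (half< m r<) ⟩
    r / 2                                       ∎
  r⊕c/2 : nimSum (suc m) r c / 2 ≡ s / 2
  r⊕c/2 = begin
    nimSum (suc m) r c / 2                      ≡⟨ nimSum-/ m r c ⟩
    nimSum m (r / 2) (c / 2)                    ≡⟨ nimSum-comm m (r / 2) (c / 2) ⟩
    nimSum m (c / 2) (r / 2)                    ≡⟨ cong (λ k → nimSum m k (r / 2)) (trans c/2≡ (nimSum-comm m (r / 2) (s / 2))) ⟩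
    nimSum m (nimSum m (s / 2) (r / 2)) (r / 2) ≡⟨ nimSum-cancelʳ m (r / 2) (half< m s<) ⟩
    s / 2                                       ∎

-- Greedy complementary sequences

mex-unique : ∀ {S : ℕ → Set} {k l} → IsMex S k → IsMex S l → k ≡ l
mex-unique {k = k} {l} (k∉ , <k) (l∉ , <l) with <-cmp k l
... | tri< k<l _ _ = contradiction (<l k<l) k∉
... | tri≈ _ k≡l _ = k≡l
... | tri> _ _ l<k = contradiction (<k l<k) l∉

-- The increment is a parameter because two instances are compared below: the block sequences and
-- the sequences `P` and `Q`.
module Greedy (f : ℕ → ℕ) where

  mutual
    taken : ℕ → List ℕ
    taken zero    = []
    taken (suc n) = lower n ∷ upper n ∷ taken n

    lower : ℕ → ℕ
    lower n = mex (taken n)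

    upper : ℕ → ℕ
    upper n = lower n + f n

  IsEntry : ℕ → ℕ → Set
  IsEntry k i = k ≡ lower i ⊎ k ≡ upper i

  ∈-taken⁺ : ∀ {n k i} → i < n → IsEntry k i → k ∈ taken n
  ∈-taken⁺ {suc n} i<1+n e with m<1+n⇒m<n∨m≡n i<1+n
  ... | inj₁ i<n = there (there (∈-taken⁺ i<n e))
  ∈-taken⁺ {suc n} i<1+n (inj₁ k≡) | inj₂ refl = here k≡
  ∈-taken⁺ {suc n} i<1+n (inj₂ k≡) | inj₂ refl = there (here k≡)

  ∈-taken⁻ : ∀ n {k} → k ∈ taken n → ∃ λ i → i < n × IsEntry k i
  ∈-taken⁻ (suc n) (here k≡)         = n , n<1+n n , inj₁ k≡
  ∈-taken⁻ (suc n) (there (here k≡)) = n , n<1+n n , inj₂ k≡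
  ∈-taken⁻ (suc n) (there (there k∈)) with i , i<n , e ← ∈-taken⁻ n k∈ =
    i , m<n⇒m<1+n i<n , e

  lower-fresh : ∀ {i n} → i < n → ¬ IsEntry (lower n) i
  lower-fresh {n = n} i<n e = proj₁ (mex-isMex (taken n)) (∈-taken⁺ i<n e)

  below-lower : ∀ {n k} → k < lower n → ∃ λ i → i < n × IsEntry k i
  below-lower {n} k< = ∈-taken⁻ n (proj₂ (mex-isMex (taken n)) k<)

  -- A value below `lower i` is taken before `i`, so it cannot be fresh at the later index `j`.
  lower-mono-< : ∀ {i j} → i < j → lower i < lower j
  lower-mono-< {i} {j} i<j with <-cmp (lower i) (lower j)
  ... | tri< lt _ _ = lt
  ... | tri≈ _ eq _ = contradiction (inj₁ (sym eq)) (lower-fresh i<j)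
  ... | tri> _ _ gt with h , h<i , e ← below-lower gt =
    contradiction e (lower-fresh (<-trans h<i i<j))

  lower-injective : ∀ {i j} → lower i ≡ lower j → i ≡ j
  lower-injective {i} {j} eq with <-cmp i j
  ... | tri< i<j _ _ = contradiction eq (<⇒≢ (lower-mono-< i<j))
  ... | tri≈ _ i≡j _ = i≡j
  ... | tri> _ _ j<i = contradiction (sym eq) (<⇒≢ (lower-mono-< j<i))

  n≤lower : ∀ n → n ≤ lower n
  n≤lower zero    = z≤n
  n≤lower (suc n) = ≤-trans (s≤s (n≤lower n)) (lower-mono-< (n<1+n n))

  covered : ∀ k → ∃ (IsEntry k)
  -- The value `k` lies below the mex at index `suc k`, which is at least `suc k`.
  covered k with i , _ , e ← below-lower {suc k} (n≤lower (suc k)) = i , e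

  lower≤upper : ∀ n → lower n ≤ upper n
  lower≤upper n = m≤m+n (lower n) (f n)

  -- If `i` comes first, monotonicity excludes equality; if `j` comes first, freshness does. The two
  -- sequences thus meet only where the increment vanishes.
  lower≡upper⇒≡ : ∀ {i j} → lower i ≡ upper j → i ≡ j
  lower≡upper⇒≡ {i} {j} eq with <-cmp i j
  ... | tri< i<j _ _ = contradiction eq (<⇒≢ (<-≤-trans (lower-mono-< i<j) (lower≤upper j)))
  ... | tri≈ _ i≡j _ = i≡j
  ... | tri> _ _ j<i = contradiction (inj₂ eq) (lower-fresh j<i)

  upper-injective : (∀ {i j} → i ≤ j → f i ≤ f j) → ∀ {i j} → upper i ≡ upper j → i ≡ j
  upper-injective f-mono {i} {j} eq with <-cmp i j
  ... | tri< i<j _ _ = contradiction eq (<⇒≢ (+-mono-<-≤ (lower-mono-< i<j) (f-mono (<⇒≤ i<j))))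
  ... | tri≈ _ i≡j _ = i≡j
  ... | tri> _ _ j<i = contradiction (sym eq) (<⇒≢ (+-mono-<-≤ (lower-mono-< j<i) (f-mono (<⇒≤ j<i))))

  lower-isMex : ∀ n → IsMex (λ k → ∃ λ i → i < n × IsEntry k i) (lower n)
  lower-isMex n = (λ (i , i<n , e) → lower-fresh i<n e) , below-lower

  -- While the increments vanish, both entries at `i` equal `i`, so the mex runs through the
  -- naturals in order. This will describe the first `a` blocks.
  lower-id : ∀ {c} → (∀ {i} → i < c → f i ≡ 0) → ∀ n → n < c → lower n ≡ n
  lower-id {c} f≡0 = <-rec _ step
    where
    step : ∀ n → (∀ {i} → i < n → i < c → lower i ≡ i) → n < c → lower n ≡ n
    step n rec n<c with m≤n⇒m<n∨m≡n (n≤lower n)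
    ... | inj₂ n≡ = sym n≡
    ... | inj₁ n< with below-lower n<
    ... | i , i<n , e = contradiction (n≡i e) (<⇒≢ i<n ∘ sym)
      where
      i<c = <-trans i<n n<c
      n≡i : IsEntry n i → n ≡ i
      n≡i (inj₁ n≡) = trans n≡ (rec i<n i<c)
      n≡i (inj₂ n≡) = trans n≡ (trans (cong₂ _+_ (rec i<n i<c) (f≡0 i<c)) (+-identityʳ i))

-- Increments that are a-fold and constant on blocks of length a inflate the
-- sequences blockwise.
module Inflate (a : ℕ) .{{_ : NonZero a}} (f g : ℕ → ℕ) (g≡ : ∀ n → g n ≡ f (n / a) * a) where

  private
    module F = Greedy f
    module G = Greedy g

  upper-from-lower : ∀ n → G.lower n ≡ n % a + F.lower (n / a) * a →
                     G.upper n ≡ n % a + F.upper (n / a) * a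
  upper-from-lower n eq = begin
    G.lower n + g n                            ≡⟨ cong₂ _+_ eq (g≡ n) ⟩
    n % a + F.lower (n / a) * a + f (n / a) * a   ≡⟨ +-assoc (n % a) _ _ ⟩
    n % a + (F.lower (n / a) * a + f (n / a) * a) ≡⟨ cong (n % a +_) (*-distribʳ-+ a (F.lower (n / a)) (f (n / a))) ⟨
    n % a + F.upper (n / a) * a                ∎
    where open ≡-Reasoning

  -- The claimed value has the mex property. Its remainder and quotient by `a` recover those of `n`,
  -- so no earlier entry equals it; smaller values are found by comparing blocks first and offsets
  -- second.
  lower-inflate : ∀ n → G.lower n ≡ n % a + F.lower (n / a) * a
  lower-inflate = <-rec _ step
    where
    step : ∀ n → (∀ {i} → i < n → G.lower i ≡ i % a + F.lower (i / a) * a) →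
           G.lower n ≡ n % a + F.lower (n / a) * a
    step n rec = mex-unique (G.lower-isMex n) (fresh , below)
      where
      v = n % a + F.lower (n / a) * a

      v%a : v % a ≡ n % a
      v%a = [r+kn]%n≡r a (F.lower (n / a)) (m%n<n n a)

      v/a : v / a ≡ F.lower (n / a)
      v/a = [r+kn]/n≡k a (F.lower (n / a)) (m%n<n n a)

      same-% : ∀ {i} k → v ≡ i % a + k * a → n % a ≡ i % a
      same-% {i} k eq = trans (sym v%a) (trans (cong (_% a) eq) ([r+kn]%n≡r a k (m%n<n i a)))

      same-/ : ∀ {i} k → v ≡ i % a + k * a → F.lower (n / a) ≡ k
      same-/ {i} k eq = trans (sym v/a) (trans (cong (_/ a) eq) ([r+kn]/n≡k a k (m%n<n i a)))

      fresh : ¬ (∃ λ i → i < n × G.IsEntry v i)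
      fresh (i , i<n , inj₁ v≡) = <⇒≢ i<n (sym (%-/-injective a
        (same-% (F.lower (i / a)) v≡′) (F.lower-injective (same-/ (F.lower (i / a)) v≡′))))
        where v≡′ = trans v≡ (rec i<n)
      fresh (i , i<n , inj₂ v≡) = <⇒≢ i<n (sym (%-/-injective a
        (same-% (F.upper (i / a)) v≡′) (F.lower≡upper⇒≡ (same-/ (F.upper (i / a)) v≡′))))
        where v≡′ = trans v≡ (upper-from-lower i (rec i<n))

      entry : ∀ {k b} → b * a + k % a < n → F.IsEntry (k / a) b →
              ∃ λ i → i < n × G.IsEntry k i
      entry {k} {b} lt e = i , i<n , Sum.map
        (λ k/a≡ → trans (k≡ k/a≡) (sym (rec i<n)))
        (λ k/a≡ → trans (k≡ k/a≡) (sym (upper-from-lower i (rec i<n)))) (e′ e)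
        where
        -- The index in block `b` with the offset of `k`.
        i = k % a + b * a
        i<n : i < n
        i<n = subst (_< n) (+-comm (b * a) (k % a)) lt
        i%a : i % a ≡ k % a
        i%a = [r+kn]%n≡r a b (m%n<n k a)
        i/a : i / a ≡ b
        i/a = [r+kn]/n≡k a b (m%n<n k a)
        e′ : F.IsEntry (k / a) b → F.IsEntry (k / a) (i / a)
        e′ = subst (F.IsEntry (k / a)) (sym i/a)
        k≡ : ∀ {l} → k / a ≡ l → k ≡ i % a + l * a
        k≡ k/a≡ = trans (m≡m%n+[m/n]*n k a) (cong₂ (λ r l → r + l * a) (sym i%a) k/a≡)

      below : ∀ {k} → k < v → ∃ λ i → i < n × G.IsEntry k i
      below {k} k<v with <⇒/<⊎%< a k<v
      ... | inj₁ k/a< with b , b< , e ← F.below-lower (subst (k / a <_) v/a k/a<) =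
        entry (/-cancel-< a (subst (_< n / a)
          (sym (trans (cong (_/ a) (+-comm (b * a) (k % a))) ([r+kn]/n≡k a b (m%n<n k a)))) b<)) e
      -- In the same block with a smaller offset, `k` is the lower entry at an earlier index of the
      -- block of `n`.
      ... | inj₂ (k/a≡ , k%a<) = entry (begin-strict
          n / a * a + k % a  <⟨ +-monoʳ-< (n / a * a) (subst (k % a <_) v%a k%a<) ⟩
          n / a * a + n % a  ≡⟨ +-comm (n / a * a) (n % a) ⟩
          n % a + n / a * a  ≡⟨ m≡m%n+[m/n]*n n a ⟨
          n                  ∎) (inj₁ (trans k/a≡ v/a))
        where open ≤-Reasoning

  upper-inflate : ∀ n → G.upper n ≡ n % a + F.upper (n / a) * a
  upper-inflate n = upper-from-lower n (lower-inflate n)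

-- Kernels of the game

module _ {a : ℕ} where

  Move-swap : ∀ {s t} → Move a s t → Move a (swap s) (swap t)
  Move-swap (fromFirst n 1≤n n≤x)        = fromSecond n 1≤n n≤x
  Move-swap (fromSecond n 1≤n n≤y)       = fromFirst n 1≤n n≤y
  Move-swap (fromBoth k 1≤k ka≤x ka≤y) = fromBoth k 1≤k ka≤y ka≤x

  move-second : ∀ {x y z} → z < y → Move a (x , y) (x , z)
  move-second {x} {y} {z} z<y = subst (λ t → Move a (x , y) (x , t))
    (m∸[m∸n]≡n (<⇒≤ z<y)) (fromSecond (y ∸ z) (m<n⇒0<n∸m z<y) (m∸n≤m y z))

  move-first : ∀ {x y z} → z < x → Move a (x , y) (z , y)
  move-first z<x = Move-swap (move-second z<x)

size : Position → ℕ
size (x , y) = x + y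

module _ {a : ℕ} .{{_ : NonZero a}} where

  1≤ka : ∀ {k} → 1 ≤ k → 1 ≤ k * a
  1≤ka 1≤k = *-mono-≤ 1≤k (>-nonZero⁻¹ a)

  Move-size : ∀ {s t} → Move a s t → size t < size s
  Move-size (fromFirst {y = y} n 1≤n n≤x)  = +-monoˡ-< y (∸-monoʳ-< 1≤n n≤x)
  Move-size (fromSecond {x = x} n 1≤n n≤y) = +-monoʳ-< x (∸-monoʳ-< 1≤n n≤y)
  Move-size (fromBoth k 1≤k ka≤x ka≤y)     =
    +-mono-< (∸-monoʳ-< (1≤ka 1≤k) ka≤x) (∸-monoʳ-< (1≤ka 1≤k) ka≤y)

  module _ (K : Position → Set)
           (independent : ∀ {s t} → K s → Move a s t → ¬ K t)
           (absorbing   : ∀ s → K s ⊎ ∃ λ t → Move a s t × K t) where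

    -- Induction on the number of stones, two moves at a time: a move from `K` leaves `K` by
    -- independence, and absorption supplies a reply back into it.
    kernel⇒P : ∀ {s} → K s → PPosition a s
    kernel⇒P {s} = go (size s) s refl
      where
      go : ∀ n s → size s ≡ n → K s → PPosition a s
      go = <-rec _ λ n rec s size≡ Ks → allMoves λ {t} s→t → reply rec size≡ Ks s→t (absorbing t)
        where
        reply : ∀ {n s t} → (∀ {k} → k < n → ∀ s → size s ≡ k → K s → PPosition a s) →
                size s ≡ n → K s → Move a s t → (K t ⊎ ∃ λ u → Move a t u × K u) → NPosition a t
        reply rec refl Ks s→t (inj₁ Kt)            = contradiction Kt (independent Ks s→t)
        reply rec refl Ks s→t (inj₂ (u , t→u , Ku)) =
          someMove t→u (rec (<-trans (Move-size t→u) (Move-size s→t)) u refl Ku)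

    P⇒kernel : ∀ {s} → PPosition a s → K s
    P⇒kernel {s} Ps with absorbing s
    ... | inj₁ Ks              = Ks
    ... | inj₂ (t , s→t , Kt) = contradiction Ps (N⇒¬P (someMove s→t (kernel⇒P Kt)))

-- Cold positions for `a` a power of two

module PowerOfTwo (m : ℕ) where

  a : ℕ
  a = 2 ^ m

  instance
    a≢0 : NonZero a
    a≢0 = m^n≢0 2 m

  infixl 6 _⊕_
  _⊕_ : ℕ → ℕ → ℕ
  _⊕_ = nimSum m

  ⊕<a : ∀ x y → x ⊕ y < a
  ⊕<a = nimSum<2^m m

  ⊕-comm : ∀ x y → x ⊕ y ≡ y ⊕ x
  ⊕-comm = nimSum-comm m

  ⊕-transpose : ∀ {x y z} → y < a → x ⊕ y ≡ z → x ⊕ z ≡ y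
  ⊕-transpose {x} {y} y<a refl = begin
    x ⊕ (x ⊕ y)  ≡⟨ ⊕-comm x (x ⊕ y) ⟩
    x ⊕ y ⊕ x    ≡⟨ cong (_⊕ x) (⊕-comm x y) ⟩
    y ⊕ x ⊕ x    ≡⟨ nimSum-cancelʳ m x y<a ⟩
    y            ∎
    where open ≡-Reasoning

  open Greedy (_/ a) public

  upper-inj : ∀ {i j} → upper i ≡ upper j → i ≡ j
  upper-inj = upper-injective (/-monoˡ-≤ a)

  -- One orientation of a cold pair. Only the blocks are ordered: when they coincide, `x` may exceed
  -- `y`.
  record Half (x y : ℕ) : Set where
    constructor half
    field
      index  : ℕ
      blockˡ : x / a ≡ lower index
      blockʳ : y / a ≡ upper index
      offset : (x % a) ⊕ (y % a) ≡ index % a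

  open Half

  Cold : Position → Set
  Cold (x , y) = Half x y ⊎ Half y x

  Cold-swap : ∀ {s} → Cold s → Cold (swap s)
  Cold-swap = Sum.swap

  offsetʳ : ∀ {x y} (h : Half x y) → (x % a) ⊕ (index h % a) ≡ y % a
  offsetʳ {x} {y} h = ⊕-transpose (m%n<n y a) (offset h)

  offset-flip : ∀ {x y} (h : Half x y) → (y % a) ⊕ (x % a) ≡ index h % a
  offset-flip {x} {y} h = trans (⊕-comm (y % a) (x % a)) (offset h)

  offsetˡ : ∀ {x y} (h : Half x y) → (y % a) ⊕ (index h % a) ≡ x % a
  offsetˡ {x} {y} h = ⊕-transpose (m%n<n x a) (offset-flip h)

  -- The block of `x` determines the index; the index then fixes the block of the partner, and
  -- cancellation of nim addition fixes its offset.
  Cold-functional : ∀ {x y z} → Cold (x , y) → Cold (x , z) → y ≡ z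
  Cold-functional (inj₁ g@(half _ _ _ _)) (inj₁ h@(half _ _ _ _))
    with refl ← lower-injective (trans (sym (blockˡ g)) (blockˡ h)) =
    %-/-injective a (trans (sym (offsetʳ g)) (offsetʳ h)) (trans (blockʳ g) (sym (blockʳ h)))
  Cold-functional (inj₂ g@(half _ _ _ _)) (inj₂ h@(half _ _ _ _))
    with refl ← upper-inj (trans (sym (blockʳ g)) (blockʳ h)) =
    %-/-injective a (trans (sym (offsetˡ g)) (offsetˡ h)) (trans (blockˡ g) (sym (blockˡ h)))
  -- With `x` in both roles, its block is a common value of `lower` and `upper`, so the indices
  -- agree and both partners lie in that block.
  Cold-functional (inj₁ g@(half _ _ _ _)) (inj₂ h@(half _ _ _ _))
    with eq ← trans (sym (blockˡ g)) (blockʳ h)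
    with refl ← lower≡upper⇒≡ eq =
    %-/-injective a (trans (sym (offsetʳ g)) (offsetˡ h))
      (trans (blockʳ g) (trans (sym eq) (sym (blockˡ h))))
  Cold-functional (inj₂ g@(half _ _ _ _)) (inj₁ h@(half _ _ _ _))
    with eq ← trans (sym (blockˡ h)) (blockʳ g)
    with refl ← lower≡upper⇒≡ eq =
    %-/-injective a (trans (sym (offsetˡ g)) (offsetʳ h))
      (trans (blockˡ g) (trans eq (sym (blockʳ h))))

  -- Diagonal moves and independence

  gap : ∀ {x y} (h : Half x y) → y / a ≡ x / a + index h / a
  gap h = trans (blockʳ h) (cong (_+ index h / a) (sym (blockˡ h)))

  -- The nim-sum of the offsets and the gap between the blocks survive a diagonal move. They are the
  -- remainder and the quotient of the index by `a`, so the index is unchanged, and the block with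
  -- it.
  Half-diagonal : ∀ {x y x′ y′} k → x % a ≡ x′ % a → y % a ≡ y′ % a →
                  x / a ≡ k + x′ / a → y / a ≡ k + y′ / a →
                  Half x y → Cold (x′ , y′) → x / a ≡ x′ / a
  Half-diagonal {x} {y} {x′} {y′} k x%≡ y%≡ x/≡ y/≡ g (inj₁ h) = begin
      x / a            ≡⟨ blockˡ g ⟩
      lower (index g)  ≡⟨ cong lower (%-/-injective a rem quot) ⟩
      lower (index h)  ≡⟨ blockˡ h ⟨
      x′ / a           ∎
    where
    open ≡-Reasoning
    rem : index g % a ≡ index h % a
    rem = trans (sym (offset g)) (trans (cong₂ _⊕_ x%≡ y%≡) (offset h))
    quot : index g / a ≡ index h / a
    quot = +-cancelˡ-≡ (k + x′ / a) _ _ (begin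
      k + x′ / a + index g / a    ≡⟨ cong (_+ index g / a) x/≡ ⟨
      x / a + index g / a         ≡⟨ gap g ⟨
      y / a                       ≡⟨ y/≡ ⟩
      k + y′ / a                  ≡⟨ cong (k +_) (gap h) ⟩
      k + (x′ / a + index h / a)  ≡⟨ +-assoc k (x′ / a) (index h / a) ⟨
      k + x′ / a + index h / a    ∎)
  -- The gaps have opposite signs, so both vanish.
  Half-diagonal {x} {y} {x′} {y′} k x%≡ y%≡ x/≡ y/≡ g (inj₂ h) = begin
      x / a                ≡⟨ blockˡ g ⟩
      lower (index g)      ≡⟨ cong lower (%-/-injective a rem quot) ⟩
      lower (index h)      ≡⟨ +-identityʳ _ ⟨
      lower (index h) + 0  ≡⟨ cong (lower (index h) +_) gapʰ ⟨
      upper (index h)      ≡⟨ blockʳ h ⟨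
      x′ / a               ∎
    where
    open ≡-Reasoning
    rem : index g % a ≡ index h % a
    rem = trans (sym (offset g)) (trans (cong₂ _⊕_ x%≡ y%≡) (offset-flip h))
    gaps : index h / a + index g / a ≡ 0
    gaps = +-cancelˡ-≡ (k + y′ / a) _ _ (begin
      k + y′ / a + (index h / a + index g / a)  ≡⟨ +-assoc (k + y′ / a) _ _ ⟨
      k + y′ / a + index h / a + index g / a    ≡⟨ cong (_+ index g / a) (+-assoc k _ _) ⟩
      k + (y′ / a + index h / a) + index g / a  ≡⟨ cong (λ z → k + z + index g / a) (gap h) ⟨
      k + x′ / a + index g / a                  ≡⟨ cong (_+ index g / a) x/≡ ⟨
      x / a + index g / a                       ≡⟨ gap g ⟨
      y / a                                     ≡⟨ y/≡ ⟩
      k + y′ / a                                ≡⟨ +-identityʳ _ ⟨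
      k + y′ / a + 0                            ∎)
    gapʰ : index h / a ≡ 0
    gapʰ = m+n≡0⇒m≡0 _ gaps
    quot : index g / a ≡ index h / a
    quot = trans (m+n≡0⇒n≡0 (index h / a) gaps) (sym gapʰ)

  Cold-diagonal : ∀ {x y x′ y′} k → x % a ≡ x′ % a → y % a ≡ y′ % a →
                  x / a ≡ k + x′ / a → y / a ≡ k + y′ / a →
                  Cold (x , y) → Cold (x′ , y′) → k ≡ 0
  Cold-diagonal k x%≡ y%≡ x/≡ y/≡ (inj₁ g) c =
    +-cancelʳ-≡ _ k 0 (trans (sym x/≡) (Half-diagonal k x%≡ y%≡ x/≡ y/≡ g c))
  Cold-diagonal k x%≡ y%≡ x/≡ y/≡ (inj₂ g) c =
    +-cancelʳ-≡ _ k 0 (trans (sym y/≡) (Half-diagonal k y%≡ x%≡ y/≡ x/≡ g (Cold-swap c)))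

  ka≤⇒/ : ∀ {k x} → k * a ≤ x → x / a ≡ k + (x ∸ k * a) / a
  ka≤⇒/ {k} {x} ka≤x = sym (trans (cong (k +_) ([m∸n*o]/o≡m/o∸n x k a))
    (m+[n∸m]≡n (subst (_≤ x / a) (m*n/n≡m k a) (/-monoˡ-≤ a ka≤x))))

  Cold-independent : ∀ {s t} → Cold s → Move a s t → ¬ Cold t
  Cold-independent c (fromFirst n 1≤n n≤x) c′ =
    <⇒≢ (∸-monoʳ-< 1≤n n≤x) (Cold-functional (Cold-swap c′) (Cold-swap c))
  Cold-independent c (fromSecond n 1≤n n≤y) c′ =
    <⇒≢ (∸-monoʳ-< 1≤n n≤y) (Cold-functional c′ c)
  Cold-independent c (fromBoth k 1≤k ka≤x ka≤y) c′ =
    <⇒≢ 1≤k (sym (Cold-diagonal k (sym (m*n≤o⇒[o∸m*n]%n≡o%n k ka≤x))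
      (sym (m*n≤o⇒[o∸m*n]%n≡o%n k ka≤y)) (ka≤⇒/ ka≤x) (ka≤⇒/ ka≤y) c c′))

  -- Winning moves from the other positions

  CanReachCold : Position → Set
  CanReachCold s = ∃ λ t → Move a s t × Cold t

  partner% : ∀ x b c → (x % a ⊕ b % a + c * a) % a ≡ x % a ⊕ b % a
  partner% x b c = [r+kn]%n≡r a c (⊕<a (x % a) (b % a))

  partner/ : ∀ x b c → (x % a ⊕ b % a + c * a) / a ≡ c
  partner/ x b c = [r+kn]/n≡k a c (⊕<a (x % a) (b % a))

  offset-partner : ∀ x b c → x % a ⊕ (x % a ⊕ b % a + c * a) % a ≡ b % a
  offset-partner x b c = trans (cong (x % a ⊕_) (partner% x b c)) (⊕-transpose (m%n<n b a) refl)

  upper-partner : ∀ {x} b → x / a ≡ lower b → Half x (x % a ⊕ b % a + upper b * a)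
  upper-partner {x} b x/≡ = half b x/≡ (partner/ x b (upper b)) (offset-partner x b (upper b))

  lower-partner : ∀ {x} b → x / a ≡ upper b → Half (x % a ⊕ b % a + lower b * a) x
  lower-partner {x} b x/≡ = half b (partner/ x b (lower b)) x/≡
    (trans (⊕-comm _ (x % a)) (offset-partner x b (lower b)))

  Absorbed : Position → Set
  Absorbed s = Cold s ⊎ CanReachCold s

  module _ {x y} (x/≤y/ : x / a ≤ y / a) where

    private
      t b′ : ℕ
      t  = y / a ∸ x / a
      -- The index prescribed by the offsets and the gap `t` if the position were cold with `x` in
      -- the lower block.
      b′ = x % a ⊕ y % a + t * a

      x/+t : x / a + t ≡ y / a
      x/+t = m+[n∸m]≡n x/≤y/

      b′/a : b′ / a ≡ t
      b′/a = [r+kn]/n≡k a t (⊕<a (x % a) (y % a))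

      b′%a : b′ % a ≡ x % a ⊕ y % a
      b′%a = [r+kn]%n≡r a t (⊕<a (x % a) (y % a))

      y/≡ : ∀ b → x / a ≡ lower b → b / a ≡ b′ / a → y / a ≡ upper b
      y/≡ b x/≡ b/≡ = trans (sym x/+t) (cong₂ _+_ x/≡ (sym (trans b/≡ b′/a)))

    -- A diagonal move keeps the offsets and the gap, hence the prescribed index `b′`; the number of
    -- steps is chosen to bring the block of `x` down to `lower b′`.
    absorbed-diagonal : lower b′ < x / a → Absorbed (x , y)
    absorbed-diagonal lt = inj₂ (_ , fromBoth k (m<n⇒0<n∸m lt) ka≤x ka≤y ,
      inj₁ (half b′ x′/ y′/ (trans (cong₂ _⊕_ x′% y′%) (sym b′%a))))
      where
      k = x / a ∸ lower b′
      ka≤x : k * a ≤ x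
      ka≤x = ≤-trans (*-monoˡ-≤ a (m∸n≤m (x / a) (lower b′))) (m/n*n≤m x a)
      ka≤y : k * a ≤ y
      ka≤y = ≤-trans (*-monoˡ-≤ a (≤-trans (m∸n≤m (x / a) (lower b′)) x/≤y/)) (m/n*n≤m y a)
      x′% : (x ∸ k * a) % a ≡ x % a
      x′% = m*n≤o⇒[o∸m*n]%n≡o%n k ka≤x
      y′% : (y ∸ k * a) % a ≡ y % a
      y′% = m*n≤o⇒[o∸m*n]%n≡o%n k ka≤y
      x′/ : (x ∸ k * a) / a ≡ lower b′
      x′/ = trans ([m∸n*o]/o≡m/o∸n x k a) (m∸[m∸n]≡n (<⇒≤ lt))
      y′/ : (y ∸ k * a) / a ≡ upper b′
      y′/ = +-cancelˡ-≡ k _ _ (begin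
        k + (y ∸ k * a) / a        ≡⟨ ka≤⇒/ ka≤y ⟨
        y / a                      ≡⟨ x/+t ⟨
        x / a + t                  ≡⟨ cong₂ _+_ (m∸n+n≡m (<⇒≤ lt)) b′/a ⟨
        k + lower b′ + b′ / a      ≡⟨ +-assoc k (lower b′) (b′ / a) ⟩
        k + upper b′               ∎)
        where open ≡-Reasoning

    -- The index `b` read off the block of `x` is compared with the prescribed `b′`: a smaller `b′`
    -- calls for a diagonal move, equality means cold, and a larger `b′` calls for lowering a single
    -- pile.
    absorbed-lower : ∀ b → x / a ≡ lower b → Absorbed (x , y)
    absorbed-lower b x/≡ with <-cmp b′ b
    ... | tri< b′<b _ _ = absorbed-diagonal (subst (lower b′ <_) (sym x/≡) (lower-mono-< b′<b))
    ... | tri≈ _ refl _ = inj₁ (inj₁ (half b′ x/≡ (y/≡ b x/≡ refl) (sym b′%a)))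
    ... | tri> _ _ b<b′ with <⇒/<⊎%< a b<b′
    -- The gap is too wide, so the block of `y` lies above `upper b` and the second pile comes down
    -- to the partner of `x`.
    ...   | inj₁ b/< = inj₂ (_ , move-second (/-cancel-< a (begin-strict
              (x % a ⊕ b % a + upper b * a) / a  ≡⟨ partner/ x b (upper b) ⟩
              lower b + b / a                    <⟨ +-monoʳ-< (lower b) (subst (b / a <_) b′/a b/<) ⟩
              lower b + t                        ≡⟨ cong (_+ t) x/≡ ⟨
              x / a + t                          ≡⟨ x/+t ⟩
              y / a                              ∎)) , inj₁ (upper-partner b x/≡))
            where open ≤-Reasoning
    -- The blocks fit index `b`, but the nim-sum of the offsets exceeds `b % a`; the mex rule tells
    -- which offset can be lowered.
    ...   | inj₂ (b/≡ , b%<) with nimSum-mex m (m%n<n x a) (m%n<n y a) (subst (b % a <_) b′%a b%<)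
    ...     | inj₁ lt = inj₂ (_ , move-first (%-<⇒< a
                (trans (partner/ y b (lower b)) (sym x/≡))
                (subst (_< x % a) (trans (⊕-comm (b % a) (y % a)) (sym (partner% y b (lower b)))) lt)) ,
                inj₁ (lower-partner b (y/≡ b x/≡ b/≡)))
    ...     | inj₂ lt = inj₂ (_ , move-second (%-<⇒< a
                (trans (partner/ x b (upper b)) (sym (y/≡ b x/≡ b/≡)))
                (subst (_< y % a) (sym (partner% x b (upper b))) lt)) ,
                inj₁ (upper-partner b x/≡))

    absorbed-≤ : Absorbed (x , y)
    absorbed-≤ with covered (x / a)
    ... | b , inj₁ x/≡ = absorbed-lower b x/≡
    ... | b , inj₂ x/≡ with m≤n⇒m<n∨m≡n (lower≤upper b)
    ...   | inj₂ eq = absorbed-lower b (trans x/≡ (sym eq))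
    -- The block of `x` is the strictly larger one of its pair, so `y` can be lowered past it to the
    -- lower partner.
    ...   | inj₁ lt = inj₂ (_ , move-second (/-cancel-< a (begin-strict
              (x % a ⊕ b % a + lower b * a) / a  ≡⟨ partner/ x b (lower b) ⟩
              lower b                            <⟨ lt ⟩
              upper b                            ≡⟨ x/≡ ⟨
              x / a                              ≤⟨ x/≤y/ ⟩
              y / a                              ∎)) , inj₂ (lower-partner b x/≡))
            where open ≤-Reasoning

  Cold-absorbing : ∀ s → Absorbed s
  Cold-absorbing (x , y) with ≤-total (x / a) (y / a)
  ... | inj₁ x≤y = absorbed-≤ x≤y
  ... | inj₂ y≤x = Sum.map Cold-swap (λ (t , s→t , c) → swap t , Move-swap s→t , Cold-swap c)
                     (absorbed-≤ y≤x)

  Cold⇒P : ∀ {s} → Cold s → PPosition a s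
  Cold⇒P = kernel⇒P Cold Cold-independent Cold-absorbing

  P⇒Cold : ∀ {s} → PPosition a s → Cold s
  P⇒Cold = P⇒kernel Cold Cold-independent Cold-absorbing

  -- The sequences p and q

  private
    instance
      a²≢0 : NonZero (a ^ 2)
      a²≢0 = m^n≢0 a 2

      a*a≢0 : NonZero (a * a)
      a*a≢0 = m*n≢0 a a

  a²≡ : a ^ 2 ≡ a * a
  a²≡ = cong (a *_) (*-identityʳ a)

  /a² : ∀ n → n / a ^ 2 ≡ n / a / a
  /a² n = trans (/-congʳ a²≡) (sym (m/n/o≡m/[n*o] n a a))

  -- Increments vanish in the first `a` blocks, so `j` and its partner share a block there and their
  -- offsets differ by nim addition of the block number. Uniqueness in the column gives the height.
  columnHeight≡ : ∀ {j} → j < a ^ 2 → columnHeight a j ≡ j % a ⊕ j / a + j / a * a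
  columnHeight≡ {j} j< = proj₂ (proj₂ (column-unique a j)) (Cold⇒P (inj₁ h))
    where
    j/a<a : j / a < a
    j/a<a = m<n*o⇒m/o<n (subst (j <_) a²≡ j<)
    lower-j/a : lower (j / a) ≡ j / a
    lower-j/a = lower-id m<n⇒m/n≡0 (j / a) j/a<a
    upper-j/a : upper (j / a) ≡ j / a
    upper-j/a = trans (cong₂ _+_ lower-j/a (m<n⇒m/n≡0 j/a<a)) (+-identityʳ (j / a))
    h : Half j (j % a ⊕ j / a + j / a * a)
    h = subst (Half j) (cong₂ (λ u v → j % a ⊕ u + v * a) (m<n⇒m%n≡m j/a<a) upper-j/a)
          (upper-partner (j / a) (sym lower-j/a))

  r+j+[h-j]≡r+h : ∀ r j h → ℤ.+ (r + j) ℤ.+ (ℤ.+ h ℤ.- ℤ.+ j) ≡ ℤ.+ (r + h)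
  r+j+[h-j]≡r+h r j h = begin
    ℤ.+ (r + j) ℤ.+ (ℤ.+ h ℤ.- ℤ.+ j)  ≡⟨ cong (ℤ._+_ (ℤ.+ (r + j))) (ℤ.m-n≡m⊖n h j) ⟩
    ℤ.+ (r + j) ℤ.+ (h ℤ.⊖ j)          ≡⟨ ℤ.distribʳ-⊖-+-pos (r + j) h j ⟩
    (r + j + h) ℤ.⊖ j                  ≡⟨ cong (λ n → (n + h) ℤ.⊖ j) (+-comm r j) ⟩
    (j + r + h) ℤ.⊖ j                  ≡⟨ cong₂ ℤ._⊖_ (+-assoc j r h) (sym (+-identityʳ j)) ⟩
    (j + (r + h)) ℤ.⊖ (j + 0)          ≡⟨ ℤ.+-cancelˡ-⊖ j (r + h) 0 ⟩
    ℤ.+ (r + h)                        ∎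
    where open ≡-Reasoning

  -- Full periods of `a ^ 2` contribute whole blocks only, so the formula for column heights carries
  -- over with the block number reduced modulo `a`: the shift permutes the offsets within the block
  -- of `n`.
  shifted≡ : ∀ n → ∣ shifted a n ∣ ≡ n % a ⊕ n / a % a + n / a * a
  shifted≡ n = begin
    ∣ shifted a n ∣                               ≡⟨ cong ∣_∣ (cong (λ i → ℤ.+ n ℤ.+ (ℤ.+ columnHeight a i ℤ.- ℤ.+ i)) toℕ-mod) ⟩
    ∣ ℤ.+ n ℤ.+ (ℤ.+ h ℤ.- ℤ.+ j) ∣               ≡⟨ cong (λ i → ∣ ℤ.+ i ℤ.+ (ℤ.+ h ℤ.- ℤ.+ j) ∣) n≡ ⟩
    ∣ ℤ.+ (r + j) ℤ.+ (ℤ.+ h ℤ.- ℤ.+ j) ∣         ≡⟨ cong ∣_∣ (r+j+[h-j]≡r+h r j h) ⟩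
    r + h                                         ≡⟨ cong (r +_) (columnHeight≡ (m%n<n n (a ^ 2))) ⟩
    r + (j % a ⊕ j / a + j / a * a)               ≡⟨ cong (r +_) (cong₂ (λ u v → u ⊕ v + v * a) j%a j/a) ⟩
    r + (n % a ⊕ n / a % a + n / a % a * a)       ≡⟨ +-comm r _ ⟩
    n % a ⊕ n / a % a + n / a % a * a + r         ≡⟨ +-assoc (n % a ⊕ n / a % a) (n / a % a * a) r ⟩
    n % a ⊕ n / a % a + (n / a % a * a + r)       ≡⟨ cong (n % a ⊕ n / a % a +_) blocks ⟩
    n % a ⊕ n / a % a + n / a * a                 ∎
    where
    open ≡-Reasoning
    j h r : ℕ
    j = n % a ^ 2
    h = columnHeight a j
    r = n / a ^ 2 * a ^ 2
    toℕ-mod : toℕ (n mod (a ^ 2)) ≡ j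
    toℕ-mod = Fin.toℕ-fromℕ< (m%n<n n (a ^ 2))
    n≡ : n ≡ r + j
    n≡ = trans (m≡m%n+[m/n]*n n (a ^ 2)) (+-comm j r)
    j%a : j % a ≡ n % a
    j%a = m∣n⇒o%n%m≡o%m a (a ^ 2) n (m∣m*n (a ^ 1))
    j/a : j / a ≡ n / a % a
    j/a = trans (cong (_/ a) (%-congʳ a²≡)) (m%[n*o]/o≡m/o%n n a a)
    blocks : n / a % a * a + r ≡ n / a * a
    blocks = begin
      n / a % a * a + n / a ^ 2 * a ^ 2      ≡⟨ cong (n / a % a * a +_) (cong₂ _*_ (/a² n) a²≡) ⟩
      n / a % a * a + n / a / a * (a * a)    ≡⟨ cong (n / a % a * a +_) (*-assoc (n / a / a) a a) ⟨
      n / a % a * a + n / a / a * a * a      ≡⟨ *-distribʳ-+ a (n / a % a) (n / a / a * a) ⟨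
      (n / a % a + n / a / a * a) * a        ≡⟨ cong (_* a) (m≡m%n+[m/n]*n (n / a) a) ⟨
      n / a * a                              ∎

  private
    increment : ℕ → ℕ
    increment n = a * (n / a ^ 2)

    module PQ = Greedy increment
    -- As `n / a ^ 2` is `n / a / a`, the increment of `Q` is `a` times the block increment.
    module I = Inflate a (_/ a) increment (λ n → trans (*-comm a _) (cong (_* a) (/a² n)))

  previous≡taken : ∀ n → previous a n ≡ PQ.taken n
  previous≡taken zero    = refl
  previous≡taken (suc n) rewrite previous≡taken n = refl

  P≡ : ∀ n → P a n ≡ n % a + lower (n / a) * a
  P≡ n = trans (cong mex (previous≡taken n)) (I.lower-inflate n)

  Q≡ : ∀ n → Q a n ≡ n % a + upper (n / a) * a
  Q≡ n = trans (cong (λ xs → mex xs + increment n) (previous≡taken n)) (I.upper-inflate n)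

  q≡ : ∀ n → q a n ≡ n % a ⊕ n / a % a + upper (n / a) * a
  q≡ n = begin
    Q a ∣ shifted a n ∣          ≡⟨ cong (Q a) (shifted≡ n) ⟩
    Q a k                        ≡⟨ Q≡ k ⟩
    k % a + upper (k / a) * a    ≡⟨ cong₂ (λ r b → r + upper b * a) ([r+kn]%n≡r a (n / a) r<a) ([r+kn]/n≡k a (n / a) r<a) ⟩
    r + upper (n / a) * a        ∎
    where
    open ≡-Reasoning
    r k : ℕ
    r = n % a ⊕ n / a % a
    k = r + n / a * a
    r<a : r < a
    r<a = ⊕<a (n % a) (n / a % a)

  -- By `q≡`, `q a n` is the upper partner of `p a n` at index `n / a`.
  Half-pq : ∀ n → Half (p a n) (q a n)
  Half-pq n = subst (Half (p a n))
    (trans (cong (λ r → r ⊕ n / a % a + upper (n / a) * a) p%a) (sym (q≡ n)))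
    (upper-partner (n / a) (trans (cong (_/ a) (P≡ n)) ([r+kn]/n≡k a (lower (n / a)) (m%n<n n a))))
    where
    p%a : p a n % a ≡ n % a
    p%a = trans (cong (_% a) (P≡ n)) ([r+kn]%n≡r a (lower (n / a)) (m%n<n n a))

  Half⇒pq : ∀ {x y} → Half x y → ∃ λ n → x ≡ p a n × y ≡ q a n
  Half⇒pq {x} {y} g@(half b x/≡ y/≡ _) = n , x≡ , y≡
    where
    open ≡-Reasoning
    n : ℕ
    -- Since `p` runs through the lower blocks offset by offset, `x` is found at its own offset in
    -- block `b`; `y` then follows from uniqueness of the partner.
    n = x % a + b * a
    n% : n % a ≡ x % a
    n% = [r+kn]%n≡r a b (m%n<n x a)
    n/ : n / a ≡ b
    n/ = [r+kn]/n≡k a b (m%n<n x a)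
    x≡ : x ≡ p a n
    x≡ = begin
      x                            ≡⟨ m≡m%n+[m/n]*n x a ⟩
      x % a + x / a * a            ≡⟨ cong (λ k → x % a + k * a) x/≡ ⟩
      x % a + lower b * a          ≡⟨ cong₂ (λ r k → r + lower k * a) n% n/ ⟨
      n % a + lower (n / a) * a    ≡⟨ P≡ n ⟨
      p a n                        ∎
    y≡ : y ≡ q a n
    y≡ = Cold-functional (inj₁ g) (inj₁ (subst (λ z → Half z (q a n)) (sym x≡) (Half-pq n)))

  P⇒pq : ∀ {s} → PPosition a s → ∃ λ n → s ≡ (p a n , q a n) ⊎ s ≡ (q a n , p a n)
  P⇒pq Ps = Sum.[ (λ h → let n , x≡ , y≡ = Half⇒pq h in n , inj₁ (cong₂ _,_ x≡ y≡))
                , (λ h → let n , x≡ , y≡ = Half⇒pq h in n , inj₂ (cong₂ _,_ y≡ x≡))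
                ] (P⇒Cold Ps)

  pq⇒P : ∀ {s} → (∃ λ n → s ≡ (p a n , q a n) ⊎ s ≡ (q a n , p a n)) → PPosition a s
  pq⇒P (n , inj₁ s≡) = subst (PPosition a) (sym s≡) (Cold⇒P (inj₁ (Half-pq n)))
  pq⇒P (n , inj₂ s≡) = subst (PPosition a) (sym s≡) (Cold⇒P (inj₂ (Half-pq n)))

theorem3p1 : ∀ (m : ℕ) →
    let a = 2 ^ m
        instance
          a≢0 : NonZero a
          a≢0 = m^n≢0 2 m
    in ∀ (pos : Position) →
       PPosition a pos ⇔ (∃ λ n → pos ≡ (p a n , q a n) ⊎ pos ≡ (q a n , p a n))
theorem3p1 m pos = mk⇔ P⇒pq pq⇒P
  where open PowerOfTwo m
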